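{- For each class $\mathcal{C}$ of languages (subsets of $\Sigma^*$) such that $\mathcal{C}$ is closed downward under $\leq^p_m$ reductions, $\mathrm{R}^p_T(\mathcal{C})=\mathrm{R}^p_{lni\text{ - }T}(\mathcal{C})=\mathrm{R}^p_{lnd\text{ - }T}(\mathcal{C})$.
   Context: $\Sigma=\{0,1\}$; $|x|$ is the length of $x$. A DPTM is a deterministic oracle Turing machine $M$ for which there is one polynomial $p$ such that, for every oracle $X\subseteq\Sigma^*$ and input $x$, $M^X(x)$ halts within $p(|x|)$ steps; $L(M^X)$ is the set of inputs accepted with oracle $X$. $A\leq^p_m B$ is the usual polynomial-time many-one reduction: there is a polynomial-time computable $f:\Sigma^*\to\Sigma^*$ with $x\in A\iff f(x)\in B$. $\mathcal{C}$ is closed downward under $\leq^p_m$ if $B\in\mathcal{C}$ and $A\leq^p_m B$ imply $A\in\mathcal{C}$. $A\leq^p_T B$: there is a DPTM $M$ with $L(M^B)=A$. $A\leq^p_{lni\text{ - }T}B$ (respectively $A\leq^p_{lnd\text{ - }T}B$): there is a DPTM $M$ with $L(M^B)=A$ such that for every input $x$ the sequence $q_1,\dots,q_k$ ($k\ge0$), in order, of queries made by $M^B(x)$ satisfies $|q_1|\ge\dots\ge|q_k|$ (respectively $|q_1|\le\dots\le|q_k|$). For each reduction type $a$, $\mathrm{R}^p_a(\mathcal{C})=\bigcup_{B\in\mathcal{C}}\{A\subseteq\Sigma^*\mid A\leq^p_a B\}$. -}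

module Defs where

open import Data.Bool using (Bool; true)
open import Data.Fin using (Fin)
open import Data.List using (List; []; _∷_; _++_; _∷ʳ_; length; foldr; map)
open import Data.List.Relation.Unary.Linked using (Linked)
open import Data.Maybe using (Maybe; just; nothing)
open import Data.Nat using (ℕ; suc; _+_; _*_; _≤_; _≥_)
open import Data.Product using (Σ-syntax; ∃-syntax; _×_; _,_)
open import Data.Vec as Vec using (Vec; _∷_)
open import Function.Bundles using (_↔_; _⇔_)
open import Level using (Level; 0ℓ; _⊔_) renaming (suc to lsuc)
open import Relation.Binary.Core using (Rel)
open import Relation.Binary.PropositionalEquality using (_≡_; _≢_)
open import Relation.Unary using (Pred; _∈_; _∉_; _≐_; ∅)

Word : Set
Word = List Bool

-- Languages are arbitrary predicates, not required to be decidable.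
Language : Set₁
Language = Pred Word 0ℓ

Class : (ℓ : Level) → Set (lsuc 0ℓ ⊔ lsuc ℓ)
Class ℓ = Pred Language ℓ

-- Coefficients, constant term first.
Polynomial : Set
Polynomial = List ℕ

eval : Polynomial → ℕ → ℕ
eval p n = foldr (λ a v → a + n * v) 0 p

Finite : Set → Set
Finite A = ∃[ n ] (A ↔ Fin n)

data Symbol (Aux : Set) : Set where
  blank : Symbol Aux
  bit   : Bool → Symbol Aux
  aux   : Aux → Symbol Aux

data Dir : Set where
  left stay right : Dir

-- A two-way infinite tape.  `lefts` and `rights` list the cells on either side
-- of the head, nearest first; all cells beyond the lists are blank.
record Tape (Aux : Set) : Set where
  constructor tape
  field
    lefts  : List (Symbol Aux)
    head   : Symbol Aux
    rights : List (Symbol Aux)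

open Tape public

module _ {Aux : Set} where

  emptyTape : Tape Aux
  emptyTape = tape [] blank []

  inputTape : Word → Tape Aux
  inputTape []      = emptyTape
  inputTape (b ∷ w) = tape [] (bit b) (map bit w)

  move : Dir → Tape Aux → Tape Aux
  move left  (tape []       h rs)       = tape [] blank (h ∷ rs)
  move left  (tape (l ∷ ls) h rs)       = tape ls l (h ∷ rs)
  move stay  t                          = t
  move right (tape ls       h [])       = tape (h ∷ ls) blank []
  move right (tape ls       h (r ∷ rs)) = tape (h ∷ ls) r rs

  writeAndMove : Symbol Aux × Dir → Tape Aux → Tape Aux
  writeAndMove (s , d) (tape ls _ rs) = move d (tape ls s rs)

-- Besides its read-write work tapes (n of them), a machine has one write-only
-- one-way tape over Σ.  For oracle machines this is the query tape; for machines
-- that compute functions it is the output tape.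
--
-- `act δ`: δ maps the scanned symbols to the next state, a bit to append to the
--          write-only tape (if any), and what to write and how to move on each
--          work tape.
-- `ask y n`: query the word on the write-only tape, erase that tape, and go to
--          state y or n according to the answer.
-- `halt b`: halt, accepting if b is true and rejecting otherwise.
data Instr (Q Aux : Set) (n : ℕ) : Set where
  act  : (Vec (Symbol Aux) n → Q × Maybe Bool × Vec (Symbol Aux × Dir) n) →
         Instr Q Aux n
  ask  : (yes no : Q) → Instr Q Aux n
  halt : Bool → Instr Q Aux n

-- A deterministic multitape oracle Turing machine, with 1 + extraTapes work
-- tapes; the first of them initially holds the input.
record Machine : Set₁ where
  field
    State      : Set
    Aux        : Set
    finState   : Finite State
    finAux     : Finite Aux
    extraTapes : ℕ
    start      : State
    program    : State → Instr State Aux (suc extraTapes)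

module _ (M : Machine) where
  open Machine M

  record Config : Set where
    constructor config
    field
      state : State
      out   : Word
      tapes : Vec (Tape Aux) (suc extraTapes)

  open Config

  initial : Word → Config
  initial x = config start [] (inputTape x ∷ Vec.replicate extraTapes emptyTape)

  append : Word → Maybe Bool → Word
  append w nothing  = w
  append w (just b) = w ∷ʳ b

  perform : (Vec (Symbol Aux) (suc extraTapes) →
             State × Maybe Bool × Vec (Symbol Aux × Dir) (suc extraTapes)) →
            Config → Config
  perform δ (config _ w ts) with δ (Vec.map head ts)
  ... | q , b , ws = config q (append w b) (Vec.zipWith writeAndMove ws ts)

  -- Step X c qs d: with oracle X, one step leads from c to d; qs is the list of
  -- (zero or one) queries made in this step.  As X need not be decidable, this
  -- is a relation rather than a function.
  data Step (X : Language) (c : Config) : List Word → Config → Set where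
    act     : ∀ {δ} → program (state c) ≡ act δ →
              Step X c [] (perform δ c)
    ask-yes : ∀ {y n} → program (state c) ≡ ask y n → out c ∈ X →
              Step X c (out c ∷ []) (config y [] (tapes c))
    ask-no  : ∀ {y n} → program (state c) ≡ ask y n → out c ∉ X →
              Step X c (out c ∷ []) (config n [] (tapes c))

  -- Run X c qs d: with oracle X, some number of steps leads from c to d, and qs
  -- is the sequence of queries made on the way, in order.
  data Run (X : Language) : Config → List Word → Config → Set where
    done : ∀ {c} → Run X c [] c
    _◅_  : ∀ {c d e qs rs} → Step X c qs d → Run X d rs e → Run X c (qs ++ rs) e

  HaltedWith : Bool → Config → Set
  HaltedWith b c = program (state c) ≡ halt b

  Halted : Config → Set
  Halted c = ∃[ b ] HaltedWith b c

  -- Every computation from c with oracle X reaches a halting configuration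
  -- within the given number of steps.  No non-halting configuration is stuck
  -- (¬ (out c ∈ X) and ¬ (out c ∉ X) are contradictory), so `next` never holds
  -- vacuously there.
  data HaltsWithin (X : Language) : ℕ → Config → Set where
    halted : ∀ {n c} → Halted c → HaltsWithin X n c
    next   : ∀ {n c} → (∀ {qs d} → Step X c qs d → HaltsWithin X n d) →
             HaltsWithin X (suc n) c

  IsPolynomialTime : Set₁
  IsPolynomialTime =
    Σ[ p ∈ Polynomial ] ∀ (X : Language) (x : Word) →
      HaltsWithin X (eval p (length x)) (initial x)

  L : Language → Language
  L X x = ∃[ qs ] ∃[ c ] (Run X (initial x) qs c × HaltedWith true c)

  QuerySequence : Language → Word → List Word → Set
  QuerySequence X x qs = ∃[ c ] (Run X (initial x) qs c × Halted c)

  OracleFree : Set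
  OracleFree = ∀ q y n → program q ≢ ask y n

  -- The oracle is irrelevant here, as this is only used for oracle-free machines.
  Computes : (Word → Word) → Set
  Computes f = ∀ x → ∃[ qs ] ∃[ c ] (Run ∅ (initial x) qs c × Halted c × out c ≡ f x)

PolynomialTimeComputable : (Word → Word) → Set₁
PolynomialTimeComputable f =
  Σ[ M ∈ Machine ] (OracleFree M × IsPolynomialTime M × Computes M f)

infix 4 _≤ᵖₘ_ _≤ᵖ-T_ _≤ᵖ-lni-T_ _≤ᵖ-lnd-T_

_≤ᵖₘ_ : Rel Language (lsuc 0ℓ)
A ≤ᵖₘ B = ∃[ f ] (PolynomialTimeComputable f × (∀ x → x ∈ A ⇔ f x ∈ B))

_≤ᵖ-T_ : Rel Language (lsuc 0ℓ)
A ≤ᵖ-T B = Σ[ M ∈ Machine ] (IsPolynomialTime M × L M B ≐ A)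

_≤ᵖ-lni-T_ : Rel Language (lsuc 0ℓ)
A ≤ᵖ-lni-T B = Σ[ M ∈ Machine ] (IsPolynomialTime M × L M B ≐ A ×
  (∀ x qs → QuerySequence M B x qs → Linked (λ u v → length u ≥ length v) qs))

_≤ᵖ-lnd-T_ : Rel Language (lsuc 0ℓ)
A ≤ᵖ-lnd-T B = Σ[ M ∈ Machine ] (IsPolynomialTime M × L M B ≐ A ×
  (∀ x qs → QuerySequence M B x qs → Linked (λ u v → length u ≤ length v) qs))

ClosedDownward : ∀ {r ℓ} → Rel Language r → Class ℓ → Set (lsuc 0ℓ ⊔ r ⊔ ℓ)
ClosedDownward _≼_ C = ∀ {A B} → B ∈ C → A ≼ B → A ∈ C

R[_] : ∀ {r ℓ} → Rel Language r → Class ℓ → Class (lsuc 0ℓ ⊔ r ⊔ ℓ)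
R[ _≼_ ] C A = ∃[ B ] (B ∈ C × A ≼ B)

{-# OPTIONS --safe #-}
module Submission where

-- All three classes coincide with the one in which every query on a given input
-- has the same length.  If A reduces to B in C through M, let B' be the preimage of B
-- under a decoding function that strips padding.  B' is in C by closure under
-- many-one reductions, and A reduces to B' by simulating M and padding each
-- query to a common length R, polynomial in |x|.  R is measured by a counter
-- running alongside the simulation: it consists of heads on k copies of the input, extended by
-- one mark, and has period (|x| + 2)^k.  It advances by one for each bit
-- written, and a query is padded until the counter has wrapped around.

open import Defs
open import Data.Bool using (Bool; true; false; not)
open import Data.Fin using (Fin; zero; suc)
open import Data.Fin.Properties using (*↔×; +↔⊎; 1↔⊤; 2↔Bool)
open import Data.List as List using (List; []; _∷_; _++_; _∷ʳ_; _ʳ++_; length; map; replicate; reverse)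
import Data.List.Properties as List
open import Data.List.Relation.Unary.All using (All; []; _∷_)
open import Data.List.Relation.Unary.Linked using (Linked; []; [-]; _∷_)
open import Data.Maybe as Maybe using (Maybe; just; nothing)
open import Data.Nat using (ℕ; zero; suc; _+_; _*_; _∸_; _^_; _≤_; _<_; _≥_; z≤n; s≤s; s≤s⁻¹)
open import Data.Nat.Properties
open import Data.Nat.Tactic.RingSolver using (solve-∀)
open import Data.Product using (∃-syntax; Σ-syntax; _×_; _,_; proj₁; proj₂)
open import Data.Product.Function.NonDependent.Propositional using (_×-↔_)
open import Data.Sum using (_⊎_; inj₁; inj₂)
open import Data.Sum.Function.Propositional using (_⊎-↔_)
open import Data.Unit using (⊤; tt)
open import Data.Vec as Vec using (Vec; []; _∷_)
import Data.Vec.Properties as Vec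
open import Function using (_∘_; const; id)
open import Function.Bundles using (_↔_; mk↔ₛ′; mk⇔)
open import Function.Construct.Composition using (_↔-∘_)
open import Function.Construct.Identity using (↔-id)
open import Function.Construct.Symmetry using (↔-sym)
open import Relation.Binary.PropositionalEquality
open import Relation.Unary using (_∈_; _∉_; _≐_)

-- Finite types

Finite-⊤ : Finite ⊤
Finite-⊤ = 1 , ↔-sym 1↔⊤

Finite-Bool : Finite Bool
Finite-Bool = 2 , ↔-sym 2↔Bool

Finite-↔ : ∀ {A B} → A ↔ B → Finite B → Finite A
Finite-↔ A↔B (n , B↔n) = n , (B↔n ↔-∘ A↔B)

Finite-⊎ : ∀ {A B} → Finite A → Finite B → Finite (A ⊎ B)
Finite-⊎ (m , A↔m) (n , B↔n) = m + n , (↔-sym +↔⊎ ↔-∘ (A↔m ⊎-↔ B↔n))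

Finite-× : ∀ {A B} → Finite A → Finite B → Finite (A × B)
Finite-× (m , A↔m) (n , B↔n) = m * n , (↔-sym *↔× ↔-∘ (A↔m ×-↔ B↔n))

Finite-Maybe : ∀ {A} → Finite A → Finite (Maybe A)
Finite-Maybe finA = Finite-↔
  (mk↔ₛ′ (λ { nothing → inj₁ tt ; (just a) → inj₂ a })
         (λ { (inj₁ tt) → nothing ; (inj₂ a) → just a })
         (λ { (inj₁ tt) → refl ; (inj₂ a) → refl })
         (λ { nothing → refl ; (just a) → refl }))
  (Finite-⊎ Finite-⊤ finA)

Finite-Vec : ∀ {A} n → Finite A → Finite (Vec A n)
Finite-Vec zero finA = Finite-↔
  (mk↔ₛ′ (const tt) (const []) (λ { tt → refl }) (λ { [] → refl })) Finite-⊤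
Finite-Vec (suc n) finA = Finite-↔
  (mk↔ₛ′ (λ { (x ∷ xs) → x , xs }) (λ { (x , xs) → x ∷ xs })
         (λ { (x , xs) → refl }) (λ { (x ∷ xs) → refl }))
  (Finite-× finA (Finite-Vec n finA))

-- Polynomials and powers of n + 2

-- An exponent that pays for the coefficients as well as the degree: a coefficient `a` is absorbed
-- by `a` further powers of `2 + n`.
degreeBound : Polynomial → ℕ
degreeBound []      = 0
degreeBound (a ∷ p) = suc (a + degreeBound p)

n≤[2+m]^n : ∀ m n → n ≤ (2 + m) ^ n
n≤[2+m]^n m zero    = z≤n
n≤[2+m]^n m (suc n) = begin
  1 + n                                ≤⟨ +-mono-≤ (m^n>0 (2 + m) n) (n≤[2+m]^n m n) ⟩
  (2 + m) ^ n + (2 + m) ^ n            ≤⟨ +-monoʳ-≤ ((2 + m) ^ n) (m≤m+n _ _) ⟩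
  (2 + m) ^ suc n                      ∎
  where open ≤-Reasoning

eval-≤ : ∀ p n → eval p n ≤ (2 + n) ^ degreeBound p
eval-≤ []      n = z≤n
eval-≤ (a ∷ p) n = begin
  a + n * eval p n
    ≤⟨ +-mono-≤ (n≤[2+m]^n n a) (*-monoʳ-≤ n (eval-≤ p n)) ⟩
  N ^ a + n * N ^ degreeBound p
    ≤⟨ +-mono-≤ (^-monoʳ-≤ N (m≤m+n a _)) (*-monoʳ-≤ n (^-monoʳ-≤ N (m≤n+m _ a))) ⟩
  N ^ (a + degreeBound p) + n * N ^ (a + degreeBound p)
    ≤⟨ m≤n+m _ (N ^ (a + degreeBound p)) ⟩
  N ^ suc (a + degreeBound p)
    ∎
  where
  open ≤-Reasoning
  N = 2 + n

-- Makes room in the clock: a step of the simulated machine emits at most two bits of code, so twice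
-- its running time has to stay below the period.
2*[2+n]^k<[2+n]^[2+k] : ∀ n k → 2 * (2 + n) ^ k < (2 + n) ^ (2 + k)
2*[2+n]^k<[2+n]^[2+k] n k = begin-strict
  2 * (2 + n) ^ k          ≤⟨ *-monoˡ-≤ ((2 + n) ^ k) (m≤m+n 2 n) ⟩
  (2 + n) ^ (1 + k)        <⟨ ^-monoʳ-< (2 + n) (s≤s (s≤s z≤n)) (n<1+n (1 + k)) ⟩
  (2 + n) ^ (2 + k)        ∎
  where open ≤-Reasoning

-- Represents `c + (2 + n) * p` in the variable `n`. Multiplying by `n` shifts coefficients, so `c`
-- is what the previous place hands on.
affine : ℕ → Polynomial → Polynomial
affine c []      = c ∷ []
affine c (a ∷ p) = (c + 2 * a) ∷ affine a p

eval-affine : ∀ c p n → eval (affine c p) n ≡ c + (2 + n) * eval p n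
eval-affine c []      n = cong (c +_) (trans (*-zeroʳ n) (sym (*-zeroʳ (2 + n))))
eval-affine c (a ∷ p) n rewrite eval-affine a p n = identity c a n (eval p n)
  where
  identity : ∀ c a n e → c + 2 * a + n * (a + (2 + n) * e) ≡ c + (2 + n) * (a + n * e)
  identity = solve-∀

power : ℕ → Polynomial
power zero    = 1 ∷ []
power (suc k) = affine 0 (power k)

eval-power : ∀ k n → eval (power k) n ≡ (2 + n) ^ k
eval-power zero    n = cong suc (*-zeroʳ n)
eval-power (suc k) n = trans (eval-affine 0 (power k) n) (cong ((2 + n) *_) (eval-power k n))

-- Deterministic computation segments

module _ {M : Machine} where
  open Machine M
  open Config

  -- Query-free steps are deterministic and independent of the oracle, so such a segment can be
  -- prefixed to, or cancelled from, a computation with any oracle.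
  data ActRun : Config M → ℕ → Config M → Set where
    []   : ∀ {c} → ActRun c 0 c
    step : ∀ {c d e δ n} → program (state c) ≡ act δ → perform M δ c ≡ d →
           ActRun d n e → ActRun c (suc n) e

  ActRun-from : ∀ {c c′ n d} → c ≡ c′ → ActRun c′ n d → ActRun c n d
  ActRun-from refl r = r

  _◅◅_ : ∀ {c d e m n} → ActRun c m d → ActRun d n e → ActRun c (m + n) e
  []            ◅◅ r = r
  step eq eq′ s ◅◅ r = step eq eq′ (s ◅◅ r)

  perform-unique : ∀ {X c δ qs d} → program (state c) ≡ act δ → Step M X c qs d →
                   (qs , d) ≡ ([] , perform M δ c)
  perform-unique eq (act eq′) with refl ← trans (sym eq) eq′ = refl
  perform-unique eq (ask-yes eq′ _) with () ← trans (sym eq) eq′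
  perform-unique eq (ask-no eq′ _)  with () ← trans (sym eq) eq′

  HaltsWithin-mono : ∀ {X m n c} → m ≤ n → HaltsWithin M X m c → HaltsWithin M X n c
  HaltsWithin-mono m≤n       (halted h) = halted h
  HaltsWithin-mono (s≤s m≤n) (next f)   = next (λ s → HaltsWithin-mono m≤n (f s))

  halts-after : ∀ {X c m d n} → ActRun c m d → HaltsWithin M X n d → HaltsWithin M X (m + n) c
  halts-after []               h = h
  halts-after {X} {n = n} (step {n = m} eq eq′ r) h =
    next λ s → subst (λ { (_ , d) → HaltsWithin M X (m + n) d })
                     (sym (perform-unique eq s))
                     (subst (HaltsWithin M X (m + n)) (sym eq′) (halts-after r h))

  run-after : ∀ {X c m d qs e} → ActRun c m d → Run M X d qs e → Run M X c qs e
  run-after []               r = r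
  run-after (step eq refl s) r = act eq ◅ run-after s r

  -- A run that ends in a halting configuration cannot stop inside the segment, where every state
  -- before `d` carries an `act`; by determinism it follows the segment.
  run-remainder : ∀ {X c m d qs e} → ActRun c m d → Run M X c qs e → Halted M e → Run M X d qs e
  run-remainder []               r        h = r
  run-remainder (step eq _ s)    done     (_ , h) with () ← trans (sym eq) h
  run-remainder (step eq refl s) (st ◅ r) h with refl ← perform-unique eq st = run-remainder s r h

  run-halted : ∀ {X c b qs d} → HaltedWith M b c → Run M X c qs d → (qs , d) ≡ ([] , c)
  run-halted h done               = refl
  run-halted h (act eq ◅ _)       with () ← trans (sym eq) h
  run-halted h (ask-yes eq _ ◅ _) with () ← trans (sym eq) h
  run-halted h (ask-no eq _ ◅ _)  with () ← trans (sym eq) h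

  Run-resp-≐ : ∀ {X Y c qs d} → X ≐ Y → Run M X c qs d → Run M Y c qs d
  Run-resp-≐ _ done = done
  Run-resp-≐ X≐Y (act eq ◅ r) = act eq ◅ Run-resp-≐ X≐Y r
  Run-resp-≐ X≐Y@(X⊆Y , _) (ask-yes eq w∈X ◅ r) = ask-yes eq (X⊆Y w∈X) ◅ Run-resp-≐ X≐Y r
  Run-resp-≐ X≐Y@(_ , Y⊆X) (ask-no eq w∉X ◅ r) = ask-no eq (w∉X ∘ Y⊆X) ◅ Run-resp-≐ X≐Y r

-- Simulation with queries of equal length

module Simulation (M′ M : Machine) (X Y : Language) (size : ℕ) where
  open Config

  -- Only halting ends are compared, so pieces taking different numbers of steps can be chained.
  -- With an undecidable oracle no halting run can be extracted constructively from `halts`; hence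
  -- runs are transferred in both directions.
  record Simulates (t : ℕ) (c′ : Config M′) (c : Config M) : Set where
    field
      halts    : HaltsWithin M′ X t c′
      sound    : ∀ {qs d′ b} → Run M′ X c′ qs d′ → HaltedWith M′ b d′ →
                 All (λ q → length q ≡ size) qs ×
                 (∃[ qs′ ] ∃[ d ] (Run M Y c qs′ d × HaltedWith M b d))
      complete : ∀ {qs d b} → Run M Y c qs d → HaltedWith M b d →
                 ∃[ qs′ ] ∃[ d′ ] (Run M′ X c′ qs′ d′ × HaltedWith M′ b d′)

  open Simulates

  simulates-after : ∀ {m t c′ d′ c} → ActRun c′ m d′ → Simulates t d′ c → Simulates (m + t) c′ c
  simulates-after r s .halts = halts-after r (halts s)
  simulates-after r s .sound run h = sound s (run-remainder r run (_ , h)) h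
  simulates-after r s .complete run h =
    let qs , d′ , run′ , h′ = complete s run h in qs , d′ , run-after r run′ , h′

  simulates-before : ∀ {t c′ c d} → ActRun c 1 d → Simulates t c′ d → Simulates t c′ c
  simulates-before r s .halts = halts s
  simulates-before r s .sound run h =
    let all , qs , d , run′ , h′ = sound s run h in all , qs , d , run-after r run′ , h′
  simulates-before r s .complete run h = complete s (run-remainder r run (_ , h)) h

  simulates-mono : ∀ {t u c′ c} → t ≤ u → Simulates t c′ c → Simulates u c′ c
  simulates-mono t≤u s .halts    = HaltsWithin-mono t≤u (halts s)
  simulates-mono t≤u s .sound    = sound s
  simulates-mono t≤u s .complete = complete s

  simulates-halt : ∀ {t c′ c b} → HaltedWith M′ b c′ → HaltedWith M b c → Simulates t c′ c
  simulates-halt h′ h .halts = halted (_ , h′)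
  simulates-halt h′ h .sound r g with refl ← run-halted h′ r with refl ← trans (sym h′) g =
    [] , _ , _ , done , h
  simulates-halt h′ h .complete r g with refl ← run-halted h r with refl ← trans (sym h) g =
    _ , _ , done , h′

  -- Each branch is conditional on its answer, since the oracle need not be decidable. Negative
  -- answers pass over by contraposition.
  simulates-ask : ∀ {t c′ c y n y′ n′} →
    Machine.program M (state c) ≡ ask y n → Machine.program M′ (state c′) ≡ ask y′ n′ →
    (out c′ ∈ X → out c ∈ Y) × (out c ∈ Y → out c′ ∈ X) → length (out c′) ≡ size →
    (out c ∈ Y → Simulates t (config y′ [] (tapes c′)) (config y [] (tapes c))) →
    (out c ∉ Y → Simulates t (config n′ [] (tapes c′)) (config n [] (tapes c))) →
    Simulates (suc t) c′ c
  simulates-ask {t} {c′} {c} eq eq′ (X⇒Y , Y⇒X) len yes no = record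
    { halts = next halts′ ; sound = sound′ ; complete = complete′ }
    where
    halts′ : ∀ {qs d} → Step M′ X c′ qs d → HaltsWithin M′ X t d
    halts′ (act e) with () ← trans (sym eq′) e
    halts′ (ask-yes e m) with refl ← trans (sym eq′) e = halts (yes (X⇒Y m))
    halts′ (ask-no e m)  with refl ← trans (sym eq′) e = halts (no (m ∘ Y⇒X))

    sound′ : ∀ {qs d′ b} → Run M′ X c′ qs d′ → HaltedWith M′ b d′ →
             All (λ q → length q ≡ size) qs ×
             (∃[ qs′ ] ∃[ d ] (Run M Y c qs′ d × HaltedWith M b d))
    sound′ done h with () ← trans (sym eq′) h
    sound′ (act e ◅ _) _ with () ← trans (sym eq′) e
    sound′ (ask-yes e m ◅ r) h with refl ← trans (sym eq′) e =
      let all , _ , _ , r′ , h′ = sound (yes (X⇒Y m)) r h in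
      len ∷ all , _ , _ , ask-yes eq (X⇒Y m) ◅ r′ , h′
    sound′ (ask-no e m ◅ r) h with refl ← trans (sym eq′) e =
      let all , _ , _ , r′ , h′ = sound (no (m ∘ Y⇒X)) r h in
      len ∷ all , _ , _ , ask-no eq (m ∘ Y⇒X) ◅ r′ , h′

    complete′ : ∀ {qs d b} → Run M Y c qs d → HaltedWith M b d →
                ∃[ qs′ ] ∃[ d′ ] (Run M′ X c′ qs′ d′ × HaltedWith M′ b d′)
    complete′ done h with () ← trans (sym eq) h
    complete′ (act e ◅ _) _ with () ← trans (sym eq) e
    complete′ (ask-yes e m ◅ r) h with refl ← trans (sym eq) e =
      let _ , _ , r′ , h′ = complete (yes m) r h in _ , _ , ask-yes eq′ (Y⇒X m) ◅ r′ , h′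
    complete′ (ask-no e m ◅ r) h with refl ← trans (sym eq) e =
      let _ , _ , r′ , h′ = complete (no m) r h in _ , _ , ask-no eq′ (m ∘ X⇒Y) ◅ r′ , h′

-- Tapes

keep : ∀ {A} → Symbol A → Symbol A × Dir
keep s = s , stay

writeAndMove-keep : ∀ {A n} (ts : Vec (Tape A) n) →
                    Vec.zipWith writeAndMove (Vec.map keep (Vec.map head ts)) ts ≡ ts
writeAndMove-keep []       = refl
writeAndMove-keep (t ∷ ts) = cong (t ∷_) (writeAndMove-keep ts)

reading : ∀ {A} → List (Symbol A) → Word → Tape A
reading ls []      = tape ls blank []
reading ls (b ∷ w) = tape ls (bit b) (map bit w)

inputTape-reading : ∀ {A} w → inputTape {A} w ≡ reading [] w
inputTape-reading []      = refl
inputTape-reading (b ∷ w) = refl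

move-reading : ∀ {A} (ls : List (Symbol A)) b w →
               move right (reading ls (b ∷ w)) ≡ reading (bit b ∷ ls) w
move-reading ls b []      = refl
move-reading ls b (c ∷ w) = refl

-- The padding code

pairs : Word → Word
pairs []      = []
pairs (b ∷ w) = true ∷ b ∷ pairs w

-- A flag `true` precedes every data bit, so the first `false` in flag position ends the word. As
-- the subtraction truncates, decoding succeeds even when `r` is too small.
encode : ℕ → Word → Word
encode r w = pairs w ++ replicate (r ∸ length (pairs w)) false

decode : Word → Word
decode (true ∷ b ∷ w) = b ∷ decode w
decode _              = []

decode-padding : ∀ n → decode (replicate n false) ≡ []
decode-padding zero    = refl
decode-padding (suc n) = refl

decode-pairs : ∀ w n → decode (pairs w ++ replicate n false) ≡ w
decode-pairs []      n = decode-padding n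
decode-pairs (b ∷ w) n = cong (b ∷_) (decode-pairs w n)

decode-encode : ∀ r w → decode (encode r w) ≡ w
decode-encode r w = decode-pairs w _

pairs-∷ʳ : ∀ w b → pairs (w ∷ʳ b) ≡ pairs w ∷ʳ true ∷ʳ b
pairs-∷ʳ []      b = refl
pairs-∷ʳ (c ∷ w) b = cong (λ v → true ∷ c ∷ v) (pairs-∷ʳ w b)

pattern expectFlag = zero
pattern expectBit  = suc zero
pattern finished   = suc (suc zero)

decoderProgram : Fin 3 → Instr (Fin 3) (Fin 0) 1
decoderProgram expectFlag = act λ where
  (bit true ∷ []) → expectBit , nothing , (bit true , right) ∷ []
  (s ∷ [])        → finished , nothing , keep s ∷ []
decoderProgram expectBit = act λ where
  (bit b ∷ []) → expectFlag , just b , (bit b , right) ∷ []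
  (s ∷ [])     → finished , nothing , keep s ∷ []
decoderProgram finished = halt true

decoder : Machine
decoder = record
  { State = Fin 3 ; Aux = Fin 0 ; finState = 3 , ↔-id _ ; finAux = 0 , ↔-id _
  ; extraTapes = 0 ; start = expectFlag ; program = decoderProgram }

-- Generalised over the output so far, `w`, and the cells already passed, `ls`, for induction on the
-- unread input.
decoder-run : ∀ v ls w → ∃[ n ] ∃[ d ]
  (n ≤ suc (length v) × Halted decoder d × Config.out d ≡ w ++ decode v ×
   ActRun {decoder} (config expectFlag w (reading ls v ∷ [])) n d)
decoder-run [] ls w =
  1 , _ , s≤s z≤n , (true , refl) , sym (List.++-identityʳ w) , step refl refl []
decoder-run (false ∷ v) ls w =
  1 , _ , s≤s z≤n , (true , refl) , sym (List.++-identityʳ w) , step refl refl []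
-- A flag with no bit after it: the flag is read first and the blank then ends the run, in agreement
-- with the default case of `decode`.
decoder-run (true ∷ []) ls w =
  2 , _ , ≤-refl , (true , refl) , sym (List.++-identityʳ w) , step refl refl (step refl refl [])
decoder-run (true ∷ b ∷ v) ls w
  with n , d , n≤ , h , eq , r ← decoder-run v (bit b ∷ bit true ∷ ls) (w ∷ʳ b) =
  2 + n , d , s≤s (s≤s n≤) , h , trans eq (List.++-assoc w (b ∷ []) (decode v)) ,
  step refl refl (step refl (cong (λ t → config expectFlag (w ∷ʳ b) (t ∷ [])) (move-reading _ b v)) r)

decoder-computation : ∀ x → ∃[ n ] ∃[ d ]
  (n ≤ suc (length x) × Halted decoder d × Config.out d ≡ decode x ×
   ActRun (initial decoder x) n d)
decoder-computation x rewrite inputTape-reading {Fin 0} x = decoder-run x [] []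

decode-computable : PolynomialTimeComputable decode
decode-computable = decoder , oracleFree , (1 ∷ 1 ∷ [] , time) , computes
  where
  oracleFree : OracleFree decoder
  oracleFree expectFlag _ _ ()
  oracleFree expectBit  _ _ ()
  oracleFree finished   _ _ ()

  bound : ∀ n → suc n ≡ 1 + n * (1 + n * 0)
  bound = solve-∀

  time : ∀ X x → HaltsWithin decoder X (eval (1 ∷ 1 ∷ []) (length x)) (initial decoder x)
  time X x with n , d , n≤ , h , _ , r ← decoder-computation x =
    HaltsWithin-mono (subst₂ _≤_ (sym (+-identityʳ n)) (bound (length x)) n≤)
                     (halts-after r (halted {n = 0} h))

  computes : Computes decoder decode
  computes x with _ , d , _ , h , eq , r ← decoder-computation x =
    [] , d , run-after r done , h , eq

_∘decode : Language → Language
(B ∘decode) w = decode w ∈ B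

∘decode-≤ᵖₘ : ∀ B → B ∘decode ≤ᵖₘ B
∘decode-≤ᵖₘ B = decode , decode-computable , λ x → mk⇔ id id

-- A clock of k tapes

-- A reflected base-(n + 2) counter: a digit is the position of a head relative
-- to a block of n + 1 marks.  The flag of a tape gives the direction of travel,
-- true being right.  A digit that has left its block turns round and
-- carries into the next tape, so each increment is a single machine step and
-- the clock restarts without rewinding.  The boolean result tells whether
-- the last tape has carried.
dir : Bool → Dir
dir true  = right
dir false = left

tick : ∀ {A k} → Vec Bool k → Vec (Symbol A) k → Bool × Vec Bool k × Vec (Symbol A × Dir) k
tick []       []           = true , [] , []
tick (d ∷ ds) (blank ∷ ss) =
  let c , ds′ , mv = tick ds ss in c , not d ∷ ds′ , (blank , dir (not d)) ∷ mv
tick (d ∷ ds) (s ∷ ss)     = false , d ∷ ds , (s , dir d) ∷ Vec.map keep ss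

module _ {A : Set} where

  -- A block of marks is ended by a blank cell or by the end of the list, since cells beyond the
  -- list are blank.
  data Marks : ℕ → List (Symbol A) → Set where
    []    : Marks 0 []
    blank : ∀ {l} → Marks 0 (blank ∷ l)
    mark  : ∀ {m b l} → Marks m l → Marks (suc m) (bit b ∷ l)

  -- The third index is the number of marks still to be crossed.
  data Digit (n : ℕ) : Bool → ℕ → Tape A → Set where
    rightwards : ∀ {a r ls h rs} → a + r ≡ suc n →
                 Marks a ls → Marks r (h ∷ rs) → Digit n true r (tape ls h rs)
    leftwards  : ∀ {a r ls h rs} → a + r ≡ suc n →
                 Marks r (h ∷ ls) → Marks a rs → Digit n false r (tape ls h rs)

  digit-blank : ∀ {n d t} → Digit n d 0 t → head t ≡ blank
  digit-blank (rightwards _ _ blank) = refl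
  digit-blank (leftwards _ blank _)  = refl

  digit-bit : ∀ {n d r t} → Digit n d (suc r) t → ∃[ b ] head t ≡ bit b
  digit-bit (rightwards _ _ (mark _)) = _ , refl
  digit-bit (leftwards _ (mark _) _)  = _ , refl

  digit-advance : ∀ {n d r t} → Digit n d (suc r) t →
                  Digit n d r (writeAndMove (head t , dir d) t)
  digit-advance (rightwards {a} {suc r} {rs = []} eq l (mark [])) =
    rightwards (trans (sym (+-suc a r)) eq) (mark l) blank
  digit-advance (rightwards {a} {suc r} {rs = _ ∷ _} eq l (mark m)) =
    rightwards (trans (sym (+-suc a r)) eq) (mark l) m
  digit-advance (leftwards {a} {suc r} {ls = []} eq (mark []) l) =
    leftwards (trans (sym (+-suc a r)) eq) blank (mark l)
  digit-advance (leftwards {a} {suc r} {ls = _ ∷ _} eq (mark m) l) =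
    leftwards (trans (sym (+-suc a r)) eq) m (mark l)

  -- With no mark left to cross, all `n + 1` marks lie behind the head. The turn puts it on the
  -- nearest of them, and the digit restarts at its maximum.
  digit-turn : ∀ {n d t} → Digit n d 0 t →
               Digit n (not d) (suc n) (writeAndMove (blank , dir (not d)) t)
  digit-turn (rightwards {a} eq l blank) with refl ← trans (sym (+-identityʳ a)) eq | mark _ ← l =
    leftwards refl l blank
  digit-turn (leftwards {a} eq blank l) with refl ← trans (sym (+-identityʳ a)) eq | mark _ ← l =
    rightwards refl blank l

  -- Digits count down, the first tape being the least significant, so the index is the number of
  -- ticks left before the one that wraps.
  data Clock (n : ℕ) : ∀ {k} → ℕ → Vec Bool k → Vec (Tape A) k → Set where
    []  : Clock n 0 [] []
    _∷_ : ∀ {k d r v t} {ds : Vec Bool k} {ts} → Digit n d r t → Clock n v ds ts →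
          Clock n (r + (2 + n) * v) (d ∷ ds) (t ∷ ts)

  data Ticked (n : ℕ) {k} : ℕ → Bool → Vec Bool k → Vec (Tape A) k → Set where
    running : ∀ {u v ds ts} → u ≡ suc v → Clock n v ds ts → Ticked n u false ds ts
    wrapped : ∀ {u v ds ts} → u ≡ 0 → suc v ≡ (2 + n) ^ k → Clock n v ds ts → Ticked n u true ds ts

  tick-clock : ∀ {n k v} {ds : Vec Bool k} {ts} → Clock n v ds ts →
    ∃[ c ] ∃[ ds′ ] ∃[ mv ] (tick ds (Vec.map head ts) ≡ (c , ds′ , mv) ×
                             Ticked n v c ds′ (Vec.zipWith writeAndMove mv ts))
  -- A clock without tapes has period 1 and wraps at every tick; this turns a carry out of the last
  -- tape into the wrap.
  tick-clock [] = true , [] , [] , refl , wrapped refl refl []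
  tick-clock {n} (_∷_ {d = d} {suc r} {t = tape ls h rs} {ds} {ts} δ cl)
    with b , refl ← digit-bit δ =
    false , d ∷ ds , _ , refl ,
    running refl (digit-advance δ ∷ subst (Clock n _ ds) (sym (writeAndMove-keep ts)) cl)
  tick-clock {n} (_∷_ {d = d} {zero} {v} {tape ls h rs} δ cl)
    with refl ← digit-blank δ | tick-clock cl
  ... | false , ds′ , mv , eq , running {v = v′} refl cl′ =
    false , not d ∷ ds′ , _ , cong (λ { (c , ds , mv) → c , not d ∷ ds , (blank , dir (not d)) ∷ mv }) eq ,
    running (*-suc (2 + n) v′) (digit-turn δ ∷ cl′)
  ... | true , ds′ , mv , eq , wrapped {v = v′} refl eq′ cl′ =
    true , not d ∷ ds′ , _ , cong (λ { (c , ds , mv) → c , not d ∷ ds , (blank , dir (not d)) ∷ mv }) eq ,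
    wrapped (*-zeroʳ (2 + n)) (trans (sym (*-suc (2 + n) v′)) (cong ((2 + n) *_) eq′)) (digit-turn δ ∷ cl′)

  Clock-replicate : ∀ n k {t} → Digit n true (suc n) t →
    ∃[ v ] (suc v ≡ (2 + n) ^ k × Clock n v (Vec.replicate k true) (Vec.replicate k t))
  Clock-replicate n zero    δ = 0 , refl , []
  Clock-replicate n (suc k) δ with v , eq , cl ← Clock-replicate n k δ =
    _ , trans (sym (*-suc (2 + n) v)) (cong ((2 + n) *_) eq) , δ ∷ cl

-- The padding machine

take-++ : ∀ {A : Set} {m n} (xs : Vec A m) (ys : Vec A n) → Vec.take m (xs Vec.++ ys) ≡ xs
take-++ []       ys = refl
take-++ (x ∷ xs) ys = cong (x ∷_) (take-++ xs ys)

drop-++ : ∀ {A : Set} {m n} (xs : Vec A m) (ys : Vec A n) → Vec.drop m (xs Vec.++ ys) ≡ ys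
drop-++ []       ys = refl
drop-++ (x ∷ xs) ys = drop-++ xs ys

-- The tapes of `padded` are those of the clock, the first of which holds the
-- input, followed by those of M.
module Padding (M : Machine) (k : ℕ) where
  open Machine M
  open Config

  Cells Moves : ℕ → Set
  Cells = Vec (Symbol Aux)
  Moves = Vec (Symbol Aux × Dir)

  PaddedState : Set
  PaddedState = Maybe (Maybe Bool) ⊎ (Bool × Vec Bool (suc k) × State)

  -- A bit b of a query is emitted in two steps, first 1 (`main` false) and then b
  -- (`main` true).  A query of M is padded while `main` is false, and asked
  -- once the clock has wrapped and `main` is true.
  pattern forward            = inj₁ nothing
  pattern backward p         = inj₁ (just p)
  pattern simulate main ds q = inj₂ (main , ds , q)

  PaddedInstr : Set
  PaddedInstr = Instr PaddedState Aux (suc k + suc extraTapes)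

  Joint : Set
  Joint = Cells (suc k) → Cells (suc extraTapes) →
          PaddedState × Maybe Bool × Moves (suc k) × Moves (suc extraTapes)

  joint : Joint → Cells (suc k + suc extraTapes) →
          PaddedState × Maybe Bool × Moves (suc k + suc extraTapes)
  joint g ss =
    let q , b , us , vs = g (Vec.take (suc k) ss) (Vec.drop (suc k) ss) in q , b , us Vec.++ vs

  goForward : Joint
  goForward (bit b ∷ _) ms =
    forward , nothing , Vec.replicate (suc k) (bit b , right) , Vec.map keep ms
  -- The extra mark lengthens the block to `length x + 1`, so a digit takes `length x + 2` values,
  -- at least two even for the empty input.
  goForward _ ms =
    backward nothing , nothing , Vec.replicate (suc k) (bit true , left) , Vec.map keep ms

  -- The pending bit is written only once it is known whether another one
  -- precedes it, so that M's tape ends up as exactly its input tape, without an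
  -- extra blank cell on the left.
  flush : Maybe Bool → Symbol Aux → Symbol Aux
  flush nothing  s = s
  flush (just b) _ = bit b

  flushLeft : Maybe Bool → Symbol Aux → Symbol Aux × Dir
  flushLeft nothing  s = keep s
  flushLeft (just b) _ = bit b , left

  goBackward : Maybe Bool → Joint
  goBackward p (bit b ∷ _) (m ∷ ms) =
    backward (just b) , nothing , Vec.replicate (suc k) (bit b , left) ,
    flushLeft p m ∷ Vec.map keep ms
  goBackward p _ (m ∷ ms) =
    simulate false (Vec.replicate (suc k) true) start , nothing ,
    Vec.replicate (suc k) (blank , right) , keep (flush p m) ∷ Vec.map keep ms

  tickIf : Maybe Bool → Vec Bool (suc k) → Cells (suc k) → Vec Bool (suc k) × Moves (suc k)
  tickIf nothing  ds cs = ds , Vec.map keep cs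
  tickIf (just _) ds cs = proj₂ (tick ds cs)

  -- Here `δ` is consulted only for whether a bit will be written. The tapes of M stay as they are,
  -- so `emitBit` evaluates `δ` on the same cells.
  emitFlag : (Cells (suc extraTapes) → State × Maybe Bool × Moves (suc extraTapes)) →
             Vec Bool (suc k) → State → Joint
  emitFlag δ ds q cs ms =
    let _ , b , _  = δ ms
        ds′ , mv   = tickIf b ds cs
    in simulate true ds′ q , Maybe.map (const true) b , mv , Vec.map keep ms

  emitBit : (Cells (suc extraTapes) → State × Maybe Bool × Moves (suc extraTapes)) →
            Vec Bool (suc k) → Joint
  emitBit δ ds cs ms =
    let q , b , ws = δ ms
        ds′ , mv   = tickIf b ds cs
    in simulate false ds′ q , b , mv , ws

  pad : Vec Bool (suc k) → State → Joint
  pad ds q cs ms =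
    let c , ds′ , mv = tick ds cs
    -- The carry `c` becomes the new `main`: the wrap itself switches from padding to asking.
    in simulate c ds′ q , just false , mv , Vec.map keep ms

  simulation : Bool → Vec Bool (suc k) → State → Instr State Aux (suc extraTapes) → PaddedInstr
  simulation false ds q (act δ)   = act (joint (emitFlag δ ds q))
  simulation true  ds q (act δ)   = act (joint (emitBit δ ds))
  simulation false ds q (ask _ _) = act (joint (pad ds q))
  simulation true  ds q (ask y n) = ask (simulate false ds y) (simulate false ds n)
  simulation _     ds q (halt b)  = halt b

  paddedProgram : PaddedState → PaddedInstr
  paddedProgram forward              = act (joint goForward)
  paddedProgram (backward p)         = act (joint (goBackward p))
  paddedProgram (simulate main ds q) = simulation main ds q (program q)

  Finite-PaddedState : Finite PaddedState
  Finite-PaddedState =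
    Finite-⊎ (Finite-Maybe (Finite-Maybe Finite-Bool))
             (Finite-× Finite-Bool (Finite-× (Finite-Vec (suc k) Finite-Bool) finState))

  padded : Machine
  padded = record
    { State      = PaddedState
    ; Aux        = Aux
    ; finState   = Finite-PaddedState
    ; finAux     = finAux
    ; extraTapes = k + suc extraTapes
    ; start      = forward
    ; program    = paddedProgram
    }

  Tapes : ℕ → Set
  Tapes = Vec (Tape Aux)

  joined : PaddedState → Word → Tapes (suc k) → Tapes (suc extraTapes) → Config padded
  joined s w cts ts = config s w (cts Vec.++ ts)

  perform-joint : ∀ (g : Joint) {s w cts ts q b us vs} →
    g (Vec.map head cts) (Vec.map head ts) ≡ (q , b , us , vs) →
    perform padded (joint g) (joined s w cts ts) ≡
    joined q (append padded w b) (Vec.zipWith writeAndMove us cts) (Vec.zipWith writeAndMove vs ts)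
  perform-joint g {cts = cts} {ts} {us = us} {vs} eq
    rewrite Vec.map-++ head cts ts
          | take-++ (Vec.map head cts) (Vec.map head ts)
          | drop-++ (Vec.map head cts) (Vec.map head ts)
          | eq
          | Vec.zipWith-++ writeAndMove us vs cts ts = refl

  actJoint : ∀ (g : Joint) cts ts {s w q b us vs cts′ ts′ n e} →
    paddedProgram s ≡ act (joint g) →
    g (Vec.map head cts) (Vec.map head ts) ≡ (q , b , us , vs) →
    Vec.zipWith writeAndMove us cts ≡ cts′ → Vec.zipWith writeAndMove vs ts ≡ ts′ →
    ActRun (joined q (append padded w b) cts′ ts′) n e →
    ActRun (joined s w cts ts) (suc n) e
  actJoint g _ _ {s} eq eq′ refl refl r = step eq (perform-joint g {s} eq′) r

  -- Setup: copying the input and starting the clock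

  forward-run : ∀ ls w ts →
    ActRun (joined forward [] (reading ls w ∷ Vec.replicate k (reading ls [])) ts) (length w)
           (joined forward [] (Vec.replicate (suc k) (reading (map bit w ʳ++ ls) [])) ts)
  forward-run ls []      ts = []
  forward-run ls (b ∷ w) ts =
    actJoint goForward (_ ∷ _) ts refl refl
      (cong₂ _∷_ (move-reading ls b w) (Vec.zipWith-replicate writeAndMove _ _))
      (writeAndMove-keep ts)
      (forward-run (bit b ∷ ls) w ts)

  pending : Word → Maybe Bool
  pending = List.head

  -- M's first tape on the way back: the first letter of the word is still pending in the state, and
  -- its cell is blank.
  uncopied : Word → Tape Aux
  uncopied []      = emptyTape
  uncopied (_ ∷ w) = tape [] blank (map bit w)

  flushLeft-pending : ∀ b w →
    writeAndMove (flushLeft (pending w) blank) (uncopied w) ≡ uncopied (b ∷ w)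
  flushLeft-pending b []      = refl
  flushLeft-pending b (c ∷ w) = refl

  flush-pending : ∀ w → writeAndMove (keep (flush (pending w) blank)) (uncopied w) ≡ inputTape w
  flush-pending []      = refl
  flush-pending (b ∷ w) = refl

  head-uncopied : ∀ w → head (uncopied w) ≡ blank
  head-uncopied []      = refl
  head-uncopied (_ ∷ _) = refl

  -- `v` is the part of the input still to be passed, reversed, and `u` the suffix already read
  -- back. Marks passed and marks ahead always total `n + 1`, so every clock tape ends as a full
  -- digit.
  backward-run : ∀ {n m h rs} v u (ts : Tapes extraTapes) →
    Marks m (h ∷ rs) → length v + m ≡ suc n →
    ∃[ t ] (Digit n true (suc n) t ×
      ActRun (joined (backward (pending u)) []
                     (Vec.replicate (suc k) (move left (tape (map bit v) h rs))) (uncopied u ∷ ts))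
             (suc (length v))
             (joined (simulate false (Vec.replicate (suc k) true) start) []
                     (Vec.replicate (suc k) t) (inputTape (v ʳ++ u) ∷ ts)))
  backward-run {h = h} {rs} [] u ts ms refl =
    tape (blank ∷ []) h rs , rightwards refl blank ms ,
    actJoint (goBackward (pending u)) (Vec.replicate (suc k) _) (_ ∷ ts) refl refl
      (Vec.zipWith-replicate writeAndMove (blank , right) (tape [] blank (h ∷ rs)))
      (cong₂ _∷_ (trans (cong (λ s → writeAndMove (keep (flush (pending u) s)) (uncopied u))
                              (head-uncopied u)) (flush-pending u))
                 (writeAndMove-keep ts))
      []
  backward-run {m = m} (b ∷ v) u ts ms eq
    with t , δ , r ← backward-run v (b ∷ u) ts (mark {b = b} ms) (trans (+-suc (length v) m) eq) =
    t , δ ,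
    actJoint (goBackward (pending u)) (Vec.replicate (suc k) _) (_ ∷ ts) refl refl
      (Vec.zipWith-replicate writeAndMove (bit b , left) _)
      (cong₂ _∷_ (trans (cong (λ s → writeAndMove (flushLeft (pending u) s) (uncopied u))
                              (head-uncopied u)) (flushLeft-pending b u))
                 (writeAndMove-keep ts))
      r

  replicate-++ : ∀ {A : Set} m {n} (x : A) →
                 Vec.replicate (m + n) x ≡ Vec.replicate m x Vec.++ Vec.replicate n x
  replicate-++ zero    x = refl
  replicate-++ (suc m) x = cong (x ∷_) (replicate-++ m x)

  setup-run : ∀ x → ∃[ t ] (Digit (length x) true (suc (length x)) t ×
    ActRun (initial padded x) (length x + suc (suc (length x)))
           (joined (simulate false (Vec.replicate (suc k) true) start) []
                   (Vec.replicate (suc k) t) (tapes (initial M x))))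
  setup-run x
    with t , δ , r ← backward-run {length x} (reverse x) [] (Vec.replicate extraTapes emptyTape)
                       (mark {b = true} []) (trans (+-comm _ 1) (cong suc (List.length-reverse x)))
    rewrite List.reverse-involutive x | List.length-reverse x =
    t , δ ,
    ActRun-from initial≡
      (forward-run [] x _ ◅◅
       actJoint goForward (Vec.replicate (suc k) (reading (map bit x ʳ++ []) [])) _ refl refl
         (trans (Vec.zipWith-replicate writeAndMove (bit true , left) (reading (map bit x ʳ++ []) []))
                (cong (λ ls → Vec.replicate (suc k) (move left (tape ls (bit true) [])))
                      (sym (List.reverse-map bit x))))
         (writeAndMove-keep _) r)
    where
    initial≡ : initial padded x ≡
      joined forward [] (reading [] x ∷ Vec.replicate k (reading [] []))
             (Vec.replicate (suc extraTapes) emptyTape)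
    initial≡ = cong₂ (λ t ts → config forward [] (t ∷ ts))
                     (inputTape-reading x) (replicate-++ k emptyTape)

  -- The simulation and its running time

  module _ (n : ℕ) where

    period : ℕ
    period = (2 + n) ^ suc k

    -- In the next f steps M emits at most 2 f bits of code, which the clock can
    -- take without wrapping.
    data Matches (f : ℕ) : Config padded → Config M → Set where
      matches : ∀ {v ds q w cts ts} → Clock n v ds cts →
                suc v + length (pairs w) ≡ period → f * 2 ≤ v →
                Matches f (joined (simulate false ds q) (pairs w) cts ts) (config q w ts)

    tick-running : ∀ {v ds} {cts : Tapes (suc k)} → Clock n (suc v) ds cts →
      ∃[ ds′ ] ∃[ mv ] (tick ds (Vec.map head cts) ≡ (false , ds′ , mv) ×
                        Clock n v ds′ (Vec.zipWith writeAndMove mv cts))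
    tick-running cl with _ , ds′ , mv , eq , running refl cl′ ← tick-clock cl = ds′ , mv , eq , cl′

    -- Two steps are spent whether or not M writes a bit. The slack in `Matches` pays for the two
    -- ticks of a written bit, so neither of them wraps.
    act-run : ∀ {f c c′ δ} → program (state c) ≡ act δ → Matches (suc f) c′ c →
              ∃[ d′ ] (ActRun c′ 2 d′ × Matches f d′ (perform M δ c))
    act-run {f} {δ = δ} eq (matches {suc (suc v)} {ds} {q} {w} {cts} {ts} cl v≡ (s≤s (s≤s f≤)))
      with δ (Vec.map head ts) in δ≡
    ... | q′ , nothing , ws =
      joined (simulate false ds q′) (pairs w) cts (Vec.zipWith writeAndMove ws ts) ,
      actJoint (emitFlag δ ds q) cts ts (cong (simulation false ds q) eq)
        (cong (λ { (_ , b , _) → let ds′ , mv = tickIf b ds (Vec.map head cts) in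
                   simulate true ds′ q , Maybe.map (const true) b , mv , _ }) δ≡)
        (writeAndMove-keep cts) (writeAndMove-keep ts)
        (actJoint (emitBit δ ds) cts ts (cong (simulation true ds q) eq)
           (cong (λ { (q , b , ws) → let ds′ , mv = tickIf b ds (Vec.map head cts) in
                      simulate false ds′ q , b , mv , ws }) δ≡)
           (writeAndMove-keep cts) refl []) ,
      matches cl v≡ (m≤n⇒m≤1+n (m≤n⇒m≤1+n f≤))
    ... | q′ , just b , ws
      with ds₁ , mv₁ , tick≡₁ , cl₁ ← tick-running cl
      with ds₂ , mv₂ , tick≡₂ , cl₂ ← tick-running cl₁ =
      joined (simulate false ds₂ q′) (pairs (w ∷ʳ b)) cts₂ (Vec.zipWith writeAndMove ws ts) ,
      actJoint (emitFlag δ ds q) cts ts (cong (simulation false ds q) eq)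
        (trans (cong (λ { (_ , b , _) → let ds′ , mv = tickIf b ds (Vec.map head cts) in
                          simulate true ds′ q , Maybe.map (const true) b , mv , _ }) δ≡)
               (cong (λ { (_ , ds′ , mv) → simulate true ds′ q , just true , mv , _ }) tick≡₁))
        refl (writeAndMove-keep ts)
        (actJoint (emitBit δ ds₁) cts₁ ts (cong (simulation true ds₁ q) eq)
           (trans (cong (λ { (q , b , ws) → let ds′ , mv = tickIf b ds₁ (Vec.map head cts₁) in
                             simulate false ds′ q , b , mv , ws }) δ≡)
                  (cong (λ { (_ , ds′ , mv) → simulate false ds′ q′ , just b , mv , ws }) tick≡₂))
           refl refl
           (ActRun-from (cong (λ u → joined _ u cts₂ _) (sym (pairs-∷ʳ w b))) [])) ,
      matches cl₂ (trans length≡ v≡) f≤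
      where
      cts₁ = Vec.zipWith writeAndMove mv₁ cts
      cts₂ = Vec.zipWith writeAndMove mv₂ cts₁

      length≡ : suc v + length (pairs (w ∷ʳ b)) ≡ suc (suc (suc v)) + length (pairs w)
      length≡ rewrite pairs-∷ʳ w b
                    | List.length-++ (pairs w ∷ʳ true) {b ∷ []}
                    | List.length-++ (pairs w) {true ∷ []} = identity v (length (pairs w))
        where
        identity : ∀ v l → suc v + (l + 1 + 1) ≡ suc (suc (suc v)) + l
        identity = solve-∀

    -- The tick that wraps also writes a bit, so a clock with `v` ticks left yields `suc v` bits of
    -- padding.
    pad-run : ∀ {v ds q w cts ts y z} → program q ≡ ask y z → Clock n v ds cts →
      ∃[ v′ ] ∃[ ds′ ] ∃[ cts′ ] (suc v′ ≡ period × Clock n v′ ds′ cts′ ×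
        ActRun (joined (simulate false ds q) w cts ts) (suc v)
               (joined (simulate true ds′ q) (w ++ replicate (suc v) false) cts′ ts))
    pad-run {v} {ds} {q} {w} {cts} {ts} eq cl with tick-clock cl
    ... | true , ds′ , mv , tick≡ , wrapped {v = v′} refl v′≡ cl′ =
      v′ , ds′ , _ , v′≡ , cl′ ,
      actJoint (pad ds q) cts ts (cong (simulation false ds q) eq)
        (cong (λ { (c , ds′ , mv) → simulate c ds′ q , just false , mv , _ }) tick≡)
        refl (writeAndMove-keep ts) []
    ... | false , ds₁ , mv , tick≡ , running {v = v₁} refl cl₁
      with v′ , ds′ , cts′ , v′≡ , cl′ , r ← pad-run {w = w ∷ʳ false} {ts = ts} eq cl₁ =
      v′ , ds′ , cts′ , v′≡ , cl′ ,
      actJoint (pad ds q) cts ts (cong (simulation false ds q) eq)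
        (cong (λ { (c , ds′ , mv) → simulate c ds′ q , just false , mv , _ }) tick≡)
        refl (writeAndMove-keep ts)
        (subst (λ u → ActRun _ (suc v₁) (joined _ u cts′ ts))
               (List.++-assoc w (false ∷ []) (replicate (suc v₁) false)) r)

    module _ (X : Language) where

      -- The oracle that M sees when the padded machine has oracle `X`. It varies with the input
      -- length, but M's time bound is uniform in the oracle; this is why the padded machine halts
      -- in time for arbitrary `X`.
      encoded : Language
      encoded w = encode period w ∈ X

      open Simulation padded M X encoded period

      -- Induction on M's remaining steps. Each costs at most `suc period`: two steps for an `act`,
      -- and for a query at most `period` steps of padding and one to ask.
      simulates : ∀ {f c′ c} → HaltsWithin M encoded f c → Matches f c′ c →
                  Simulates (f * suc period) c′ c
      simulates {c = c} (halted (b , h)) (matches {ds = ds} _ _ _) =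
        simulates-halt (cong (simulation false ds (state c)) h) h
      simulates {suc f} {c = c} (next s) m with program (state c) in eq
      simulates {suc f} {c = c} (next s) (matches {ds = ds} _ _ _) | halt b =
        simulates-halt (cong (simulation false ds (state c)) eq) eq
      simulates {suc f} (next s) m | act δ
        with d′ , r , m′ ← act-run eq m =
        simulates-before (step eq refl [])
          (simulates-mono (+-monoˡ-≤ (f * suc period) (s≤s (m^n>0 (2 + n) (suc k))))
            (simulates-after r (simulates (s (act eq)) m′)))
      simulates {suc f} (next s) (matches {v} {w = w} {ts = ts} cl v≡ f≤) | ask y z
        with v′ , ds′ , cts′ , v′≡ , cl′ , r ← pad-run {w = pairs w} {ts = ts} eq cl =
        simulates-mono time≤
          (simulates-after r
            (simulates-ask eq (cong (simulation true ds′ _) eq)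
              (subst X encode≡ , subst X (sym encode≡)) length≡
              (λ w∈ → simulates (s (ask-yes eq w∈)) (rematch y))
              (λ w∉ → simulates (s (ask-no eq w∉)) (rematch z))))
        where
        l = length (pairs w)

        v≤ : suc v ≤ period
        v≤ = m+n≤o⇒m≤o (suc v) (≤-reflexive v≡)

        -- After an answer the query tape is empty and the clock freshly wrapped, with at least as
        -- many ticks left as before the padding, so the invariant holds anew.
        rematch : ∀ q → Matches f (joined (simulate false ds′ q) [] cts′ ts) (config q [] ts)
        rematch q = matches cl′ (trans (+-identityʳ _) v′≡)
          (≤-trans (m≤n+m (f * 2) 2) (≤-trans f≤ (s≤s⁻¹ (≤-trans v≤ (≤-reflexive (sym v′≡))))))

        encode≡ : pairs w ++ replicate (suc v) false ≡ encode period w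
        encode≡ = cong (λ m → pairs w ++ replicate m false)
                       (sym (trans (cong (_∸ l) (sym v≡)) (m+n∸n≡m (suc v) l)))

        length≡ : length (pairs w ++ replicate (suc v) false) ≡ period
        length≡ = trans (List.length-++ (pairs w))
                  (trans (cong (l +_) (List.length-replicate (suc v)))
                  (trans (+-comm l (suc v)) v≡))

        time≤ : suc v + suc (f * suc period) ≤ suc f * suc period
        time≤ = ≤-trans (≤-reflexive (+-suc (suc v) _)) (s≤s (+-monoˡ-≤ _ v≤))

  simulates-initial : ∀ X x {f} → f * 2 < period (length x) →
    HaltsWithin M (encoded (length x) X) f (initial M x) →
    Simulation.Simulates padded M X (encoded (length x) X) (period (length x))
              (length x + suc (suc (length x)) + f * suc (period (length x)))
              (initial padded x) (initial M x)
  simulates-initial X x {f} f< h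
    with t , δ , r ← setup-run x
    with v , v≡ , cl ← Clock-replicate (length x) (suc k) δ =
    Simulation.simulates-after padded M X _ _ r
      (simulates _ X h (matches cl (trans (+-identityʳ _) v≡) (s≤s⁻¹ (subst (f * 2 <_) (sym v≡) f<))))

-- Equal-length queries

_≤ᵖ-eq-T_ : Language → Language → Set₁
A ≤ᵖ-eq-T B = Σ[ M ∈ Machine ] (IsPolynomialTime M × L M B ≐ A ×
  (∀ x qs → QuerySequence M B x qs → ∃[ r ] All (λ q → length q ≡ r) qs))

-- With `m = 2 + n`, `s` is the setup time, `e` the time of M and `m ^ (2 + d)` the period. As `m`
-- is at least 2, twice a power fits into the next power.
power-bound : ∀ {m} s e d → 2 ≤ m → s ≤ m ^ 2 → e ≤ m ^ d →
              s + e * suc (m ^ (2 + d)) ≤ m ^ (6 + 2 * d)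
power-bound {m@(suc _)} s e d 2≤m s≤ e≤ = begin
  s + e * suc (m ^ (2 + d))
    ≤⟨ +-mono-≤ (≤-trans s≤ (^-monoʳ-≤ m (m≤m+n 2 (3 + 2 * d)))) (*-mono-≤ e≤ suc≤) ⟩
  m ^ k + m ^ d * m ^ (3 + d)
    ≤⟨ +-monoʳ-≤ (m ^ k) product≤ ⟩
  m ^ k + m ^ k
    ≡⟨ cong (m ^ k +_) (+-identityʳ (m ^ k)) ⟨
  2 * m ^ k
    ≤⟨ *-monoˡ-≤ (m ^ k) 2≤m ⟩
  m ^ (1 + k)
    ∎
  where
  open ≤-Reasoning
  k = 5 + 2 * d

  suc≤ : suc (m ^ (2 + d)) ≤ m ^ (3 + d)
  suc≤ = ^-monoʳ-< m 2≤m (n<1+n (2 + d))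

  product≤ : m ^ d * m ^ (3 + d) ≤ m ^ k
  product≤ = begin
    m ^ d * m ^ (3 + d) ≡⟨ ^-distribˡ-+-* m d (3 + d) ⟨
    m ^ (d + (3 + d))   ≤⟨ ^-monoʳ-≤ m (≤-trans (≤-reflexive (identity d)) (m≤n+m (3 + 2 * d) 2)) ⟩
    m ^ k               ∎
    where
    identity : ∀ d → d + (3 + d) ≡ 3 + 2 * d
    identity = solve-∀

padded-time : ∀ p → ∃[ q ] ∀ n →
  n + suc (suc n) + eval p n * suc ((2 + n) ^ (2 + degreeBound p)) ≤ eval q n
padded-time p = power (6 + 2 * degreeBound p) , λ n →
  subst (n + suc (suc n) + eval p n * suc ((2 + n) ^ (2 + degreeBound p)) ≤_)
    (sym (eval-power (6 + 2 * degreeBound p) n))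
    (power-bound _ (eval p n) (degreeBound p) (m≤m+n 2 n) (setup≤ n) (eval-≤ p n))
  where
  identity : ∀ n → n + (2 + n) + (2 + 2 * n + n * n) ≡ (2 + n) * ((2 + n) * 1)
  identity = solve-∀

  setup≤ : ∀ n → n + suc (suc n) ≤ (2 + n) ^ 2
  setup≤ n = m+n≤o⇒m≤o _ (≤-reflexive (identity n))

≤ᵖ-T⇒≤ᵖ-eq-T : ∀ {A B} → A ≤ᵖ-T B → A ≤ᵖ-eq-T (B ∘decode)
≤ᵖ-T⇒≤ᵖ-eq-T {A} {B} (M , (p , time) , LB⊆A , A⊆LB) with q , bound ← padded-time p =
  padded , (q , λ X x → HaltsWithin-mono (bound (length x)) (halts (sim X x))) ,
  (L⊆A , A⊆L) , equal
  where
  -- The clock then has `2 + degreeBound p` tapes, so its period exceeds twice the running time of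
  -- M.
  open Padding M (suc (degreeBound p))
  open Simulation.Simulates

  sim : ∀ X x → Simulation.Simulates padded M X (encoded (length x) X) (period (length x))
                  (length x + suc (suc (length x)) + eval p (length x) * suc (period (length x)))
                  (initial padded x) (initial M x)
  sim X x = simulates-initial X x
    (≤-<-trans (≤-trans (≤-reflexive (*-comm (eval p (length x)) 2)) (*-monoʳ-≤ 2 (eval-≤ p (length x))))
               (2*[2+n]^k<[2+n]^[2+k] (length x) (degreeBound p)))
    (time _ x)

  -- Since `decode` undoes `encode` at every length, M sees `B` itself for all inputs, although the
  -- padded queries vary with the input length.
  encoded≐B : ∀ n → encoded n (B ∘decode) ≐ B
  encoded≐B n = (λ {w} → subst B (decode-encode (period n) w)) ,
                (λ {w} → subst B (sym (decode-encode (period n) w)))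

  L⊆A : ∀ {x} → L padded (B ∘decode) x → A x
  L⊆A {x} (_ , _ , r , h) =
    let _ , qs , d , r′ , h′ = sound (sim (B ∘decode) x) r h
    in LB⊆A (qs , d , Run-resp-≐ (encoded≐B (length x)) r′ , h′)

  A⊆L : ∀ {x} → A x → L padded (B ∘decode) x
  A⊆L {x} x∈A =
    let _ , _ , r , h = A⊆LB x∈A
        ⊆B , ⊇B       = encoded≐B (length x)
    in complete (sim (B ∘decode) x) (Run-resp-≐ (⊇B , ⊆B) r) h

  equal : ∀ x qs → QuerySequence padded (B ∘decode) x qs → ∃[ r ] All (λ q → length q ≡ r) qs
  equal x qs (_ , r , _ , h) = period (length x) , proj₁ (sound (sim (B ∘decode) x) r h)

-- From equal lengths to monotone lengths

equal⇒Linked : ∀ {_∼_ : ℕ → ℕ → Set} → (∀ {n} → n ∼ n) → ∀ {r} {qs : List Word} →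
               All (λ q → length q ≡ r) qs → Linked (λ u v → length u ∼ length v) qs
equal⇒Linked ∼-refl []       = []
equal⇒Linked ∼-refl (_ ∷ []) = [-]
equal⇒Linked {_∼_} ∼-refl (refl ∷ eqs@(eq ∷ _)) =
  subst (_ ∼_) (sym eq) ∼-refl ∷ equal⇒Linked {_∼_} ∼-refl eqs

theorem4p15 : ∀ {ℓ} (C : Class ℓ) → ClosedDownward _≤ᵖₘ_ C →
    (R[ _≤ᵖ-T_ ] C ≐ R[ _≤ᵖ-lni-T_ ] C) × (R[ _≤ᵖ-lni-T_ ] C ≐ R[ _≤ᵖ-lnd-T_ ] C)
theorem4p15 C closed =
  -- The inclusion into the Turing class forgets the condition on lengths; every other one passes
  -- through the equal-length class.
  (eq⊆lni ∘ T⊆eq , lni⊆T) , (eq⊆lnd ∘ T⊆eq ∘ lni⊆T , eq⊆lni ∘ T⊆eq ∘ lnd⊆T)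
  where
  T⊆eq : ∀ {A} → R[ _≤ᵖ-T_ ] C A → R[ _≤ᵖ-eq-T_ ] C A
  -- Downward closure enters here, where the oracle changes from `B` to its preimage under `decode`.
  T⊆eq (B , B∈C , A≤B) = B ∘decode , closed B∈C (∘decode-≤ᵖₘ B) , ≤ᵖ-T⇒≤ᵖ-eq-T A≤B

  eq⊆lni : ∀ {A} → R[ _≤ᵖ-eq-T_ ] C A → R[ _≤ᵖ-lni-T_ ] C A
  eq⊆lni (B , B∈C , M , time , L≐A , equal) =
    B , B∈C , M , time , L≐A , λ x qs s → equal⇒Linked {_≥_} ≤-refl (proj₂ (equal x qs s))

  eq⊆lnd : ∀ {A} → R[ _≤ᵖ-eq-T_ ] C A → R[ _≤ᵖ-lnd-T_ ] C A
  eq⊆lnd (B , B∈C , M , time , L≐A , equal) =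
    B , B∈C , M , time , L≐A , λ x qs s → equal⇒Linked {_≤_} ≤-refl (proj₂ (equal x qs s))

  lni⊆T : ∀ {A} → R[ _≤ᵖ-lni-T_ ] C A → R[ _≤ᵖ-T_ ] C A
  lni⊆T (B , B∈C , M , time , L≐A , _) = B , B∈C , M , time , L≐A

  lnd⊆T : ∀ {A} → R[ _≤ᵖ-lnd-T_ ] C A → R[ _≤ᵖ-T_ ] C A
  lnd⊆T (B , B∈C , M , time , L≐A , _) = B , B∈C , M , time , L≐A
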